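{- Let $\mathcal L$ be a class of laminar set systems such that, for every $n\in\mathbb N$, $\mathcal L$ contains a set system whose laminar tree is a star whose root has at least $n$ children. Then $\mathrm{EVEN}$ is not $\{\mathsf{SET}\}$-definable for $\mathcal L$ over $\mathsf{MSO}$; that is, there is no $\mathsf{MSO}$-formula $\phi(X)$ over $\{\mathsf{SET}\}$ with one free set variable $X$ such that for every $(U,\mathcal F)\in\mathcal L$ and every $X\subseteq U$, $\phi(X)$ is true in $(U,\mathcal F)$ if and only if $|X|$ is even.
   Context: All structures are finite. $\mathsf{MSO}$ is monadic second-order logic (quantification over elements and sets of elements, no counting predicates). A set system $(U,\mathcal F)$ is a finite non-empty set $U$ with a family $\mathcal F$ of non-empty subsets of $U$; it is modelled as a structure with universe $U$ over the vocabulary $\{\mathsf{SET}\}$, where $\mathsf{SET}$ is a unary predicate on subsets of the universe and $\mathsf{SET}(X)$ holds iff $X\in\mathcal F$. It is laminar if $U\in\mathcal F$, $\{u\}\in\mathcal F$ for all $u\in U$, and for all $F_1,F_2\in\mathcal F$ the set $F_1\cap F_2$ is one of $\emptyset,F_1,F_2$. The laminar tree of a laminar set system is the rooted tree whose nodes correspond bijectively to the sets in $\mathcal F$, where the node of $F$ is a descendant of the node of $F'$ iff $F\subseteq F'$. A star is a rooted tree consisting of a root all of whose children are leaves. -}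

module Defs where

open import Data.Bool using (Bool; T)
open import Data.Fin using (Fin)
import Data.Fin.Properties as Fin
open import Data.Fin.Subset using (Subset; _∈_; _⊆_; _∩_; ⊤; ⊥; ⁅_⁆; ∣_∣; Nonempty; Empty)
open import Data.Maybe using (Maybe; just; nothing)
import Data.Maybe.Properties as Maybe
open import Data.Nat using (ℕ; suc; NonZero)
open import Data.Nat.Divisibility using (_∣_)
open import Data.Product using (Σ; ∃; _×_; proj₁)
open import Data.Sum using (_⊎_)
open import Data.Vec using (Vec; []; _∷_; lookup; tabulate)
open import Function.Bundles using (_⇔_; _⤖_; module Bijection)
open import Relation.Binary.Construct.Closure.ReflexiveTransitive using (Star)
open import Relation.Binary.PropositionalEquality using (_≡_)
open import Relation.Nullary using (¬_; does)
open import Relation.Unary using (Pred)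

-- A finite universe is represented by Fin size, its subsets by Subset size.
-- The family is given by its characteristic function.
record SetSystem : Set where
  field
    size              : ℕ
    universe-nonempty : NonZero size
    family            : Subset size → Bool

  SET : Subset size → Set
  SET X = T (family X)

  field
    members-nonempty : ∀ {X} → SET X → Nonempty X

  Member : Set
  Member = Σ (Subset size) SET

record Laminar (S : SetSystem) : Set where
  open SetSystem S
  field
    universe∈   : SET ⊤
    singleton∈  : ∀ u → SET ⁅ u ⁆
    non-crossing : ∀ {F₁ F₂} → SET F₁ → SET F₂ →
                   F₁ ∩ F₂ ≡ ⊥ ⊎ F₁ ∩ F₂ ≡ F₁ ⊎ F₁ ∩ F₂ ≡ F₂

-- Acyclicity, and the fact that every non-root node has a parent, follow
-- from root-top together with rootless.
record RootedTree : Set where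
  field
    order  : ℕ
    root   : Fin order
    parent : Fin order → Maybe (Fin order)

  Node : Set
  Node = Fin order

  -- u is a descendant of v; every node is a descendant of itself.
  Descendant : Node → Node → Set
  Descendant = Star (λ u v → parent u ≡ just v)

  field
    rootless : parent root ≡ nothing
    root-top : ∀ v → Descendant v root

  children : Node → Subset order
  children v = tabulate λ u → does (Maybe.≡-dec Fin._≟_ (parent u) (just v))

  IsLeaf : Node → Set
  IsLeaf v = Empty (children v)

  IsStar : Set
  IsStar = ∀ {v} → v ∈ children root → IsLeaf v

record _IsLaminarTreeOf_ (𝒯 : RootedTree) (S : SetSystem) : Set where
  open RootedTree 𝒯
  open SetSystem S
  field
    nodes⤖members : Node ⤖ Member

  setOf : Node → Subset size
  setOf v = proj₁ (Bijection.to nodes⤖members v)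

  field
    descendant⇔⊆ : ∀ u v → Descendant u v ⇔ setOf u ⊆ setOf v

-- MSO formulas over {SET} with e free element variables and s free set
-- variables, as de Bruijn indices: a quantifier binds index zero.
data Formula (e s : ℕ) : Set where
  _≐_         : (x y : Fin e) → Formula e s
  _∈̇_         : (x : Fin e) (X : Fin s) → Formula e s
  SĖT         : (X : Fin s) → Formula e s
  ¬̇_          : Formula e s → Formula e s
  _∧̇_ _∨̇_ _⇒̇_ : Formula e s → Formula e s → Formula e s
  ∃ᵉ ∀ᵉ       : Formula (suc e) s → Formula e s
  ∃ˢ ∀ˢ       : Formula e (suc s) → Formula e s

-- Atoms are decidable and quantifiers range over finite types, so this
-- semantics is decidable and agrees with the classical one.
module _ (S : SetSystem) where
  open SetSystem S

  Sat : ∀ {e s} → Formula e s → Vec (Fin size) e → Vec (Subset size) s → Set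
  Sat (x ≐ y) ρ σ = lookup ρ x ≡ lookup ρ y
  Sat (x ∈̇ X) ρ σ = lookup ρ x ∈ lookup σ X
  Sat (SĖT X) ρ σ = SET (lookup σ X)
  Sat (¬̇ φ)   ρ σ = ¬ Sat φ ρ σ
  Sat (φ ∧̇ ψ) ρ σ = Sat φ ρ σ × Sat ψ ρ σ
  Sat (φ ∨̇ ψ) ρ σ = Sat φ ρ σ ⊎ Sat ψ ρ σ
  Sat (φ ⇒̇ ψ) ρ σ = Sat φ ρ σ → Sat ψ ρ σ
  Sat (∃ᵉ φ)  ρ σ = ∃ λ u → Sat φ (u ∷ ρ) σ
  Sat (∀ᵉ φ)  ρ σ = ∀ u → Sat φ (u ∷ ρ) σ
  Sat (∃ˢ φ)  ρ σ = ∃ λ X → Sat φ ρ (X ∷ σ)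
  Sat (∀ˢ φ)  ρ σ = ∀ X → Sat φ ρ (X ∷ σ)

SetPredicate : Set₁
SetPredicate = ∀ {n} → Subset n → Set

EVEN : SetPredicate
EVEN X = 2 ∣ ∣ X ∣

Definable : ∀ {ℓ} → SetPredicate → Pred SetSystem ℓ → Set ℓ
Definable P 𝓛 =
  Σ (Formula 0 1) λ φ →
    ∀ S → 𝓛 S → (X : Subset (SetSystem.size S)) →
      Sat S φ [] (X ∷ []) ⇔ P X

{-# OPTIONS --safe #-}

-- In a set system whose laminar tree is a star, SET holds exactly of the universe and of
-- the singletons, so it is invariant under all permutations of the universe.  Fix such a
-- system and a formula φ.  If the universe is large, there are sets Z and Z ∪ {p} such
-- that p has many points interchangeable with it in both.  A back-and-forth argument
-- inside this one system shows that φ cannot tell two valuations apart if they differ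
-- only at p and p has many twins under each.  When a set is quantified, the twins under
-- each valuation split into two halves, and p can be placed on the larger side: in the
-- valuation where the set was chosen, by swapping p with a twin; in the other, by choosing
-- the answer.  So about half of the twins survive.
module Submission where

open import Data.Bool using (Bool; true; false; not)
open import Data.Bool.Properties using (T-irrelevant; ¬-not)
open import Data.Fin using (Fin; zero; suc)
open import Data.Fin.Permutation
  using (Permutation′; _⟨$⟩ʳ_; _⟨$⟩ˡ_; inverseˡ; inverseʳ; flip; transpose)
  renaming (id to idₚ)
open import Data.Fin.Properties using (_≟_; injective⇒≤)
open import Data.Fin.Subset
  using (Subset; inside; outside; _∈_; _∉_; _⊆_; _∩_; ∁; ⊤; ⊥; ⁅_⁆; ∣_∣; Nonempty)
open import Data.Fin.Subset.Properties
  using (∣p∣≤n; ∣⊥∣≡0; ∣⁅x⁆∣≡1; ∣p∩q∣≤∣q∣; ∣∁p∣≡n∸∣p∣; x∈⁅x⁆; x∈⁅y⁆⇒x≡y; ∈⊤; ⊆⊤;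
         ⊆-antisym; x∈p∩q⁻; x∈∁p⇒x∉p; nonempty?; Empty-unique)
open import Data.Maybe using (just)
open import Data.Maybe.Properties using (≡-dec)
open import Data.Nat using (ℕ; zero; suc; _≤_; _<_; _+_; _∸_; _⊔_; z≤n; s≤s; s≤s⁻¹)
open import Data.Nat.Divisibility
  using (_∣_; divides; ∣m+n∣m⇒∣n; ∣1⇒≡1; ∣m∣n⇒∣m+n; ∣-refl)
open import Data.Nat.Properties
  using (≤-trans; ≤-reflexive; +-mono-≤; +-monoˡ-≤; +-suc; +-comm; m≤m+n; m+n∸n≡m;
         ∸-monoˡ-≤; m≤m⊔n; m≤n⊔m; n≤1+n; <-asym; ≰⇒>; ≮⇒≥; _≤?_; _<?_; module ≤-Reasoning)
open import Data.Product using (Σ; ∃; ∃-syntax; _×_; _,_; proj₁; proj₂)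
open import Data.Product.Properties using (Σ-≡,≡→≡)
open import Data.Sum using (_⊎_; inj₁; inj₂)
open import Data.Vec using (Vec; []; _∷_; lookup; tabulate; _[_]≔_; there)
open import Data.Vec.Properties
  using (lookup∘tabulate; []=⇒lookup; lookup⇒[]=; lookup∘update; lookup∘update′)
open import Function using (_∘_)
open import Function.Bundles using (_⇔_; mk⇔; module Equivalence; module Bijection)
open import Relation.Binary.Construct.Closure.ReflexiveTransitive using (ε; _◅_)
open import Relation.Binary.PropositionalEquality
  using (_≡_; _≢_; refl; sym; trans; cong; subst; module ≡-Reasoning)
open import Relation.Nullary using (¬_; yes; no; contradiction)
open import Relation.Nullary.Decidable using (dec-true)
open import Relation.Unary using (Pred)
open import Defs

open Equivalence using (to; from)

private
  variable
    e s k l m n : ℕ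
    p q u v : Fin n

-- Counting in finite subsets.

∈-resp : {X : Subset n} {Y : Subset m} →
         lookup X u ≡ lookup Y v → u ∈ X → v ∈ Y
∈-resp {v = v} {Y = Y} eq u∈X = lookup⇒[]= v Y (trans (sym eq) ([]=⇒lookup u∈X))

∣p∣≡∣p∩q∣+∣p∩∁q∣ : (A Y : Subset n) → ∣ A ∣ ≡ ∣ A ∩ Y ∣ + ∣ A ∩ ∁ Y ∣
∣p∣≡∣p∩q∣+∣p∩∁q∣ []            []            = refl
∣p∣≡∣p∩q∣+∣p∩∁q∣ (inside  ∷ A) (inside  ∷ Y) = cong suc (∣p∣≡∣p∩q∣+∣p∩∁q∣ A Y)
∣p∣≡∣p∩q∣+∣p∩∁q∣ (inside  ∷ A) (outside ∷ Y) =
  trans (cong suc (∣p∣≡∣p∩q∣+∣p∩∁q∣ A Y)) (sym (+-suc _ _))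
∣p∣≡∣p∩q∣+∣p∩∁q∣ (outside ∷ A) (_       ∷ Y) = ∣p∣≡∣p∩q∣+∣p∩∁q∣ A Y

remove-≤ : (A : Subset n) (u : Fin n) → suc k ≤ ∣ A ∣ → k ≤ ∣ A ∩ ∁ ⁅ u ⁆ ∣
remove-≤ {k = k} A u k<∣A∣ = s≤s⁻¹ (begin
  suc k                               ≤⟨ k<∣A∣ ⟩
  ∣ A ∣                               ≡⟨ ∣p∣≡∣p∩q∣+∣p∩∁q∣ A ⁅ u ⁆ ⟩
  ∣ A ∩ ⁅ u ⁆ ∣ + ∣ A ∩ ∁ ⁅ u ⁆ ∣     ≤⟨ +-monoˡ-≤ _ (∣p∩q∣≤∣q∣ A ⁅ u ⁆) ⟩
  ∣ ⁅ u ⁆ ∣ + ∣ A ∩ ∁ ⁅ u ⁆ ∣         ≡⟨ cong (_+ ∣ A ∩ ∁ ⁅ u ⁆ ∣) (∣⁅x⁆∣≡1 u) ⟩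
  suc ∣ A ∩ ∁ ⁅ u ⁆ ∣                 ∎)
  where open ≤-Reasoning

∈-remove⁻ : (A : Subset n) → v ∈ A ∩ ∁ ⁅ u ⁆ → v ∈ A × v ≢ u
∈-remove⁻ {u = u} A v∈ with x∈p∩q⁻ A (∁ ⁅ u ⁆) v∈
... | v∈A , v∈∁ = v∈A , λ { refl → x∈∁p⇒x∉p v∈∁ (x∈⁅x⁆ u) }

0<∣p∣⇒nonempty : (A : Subset n) → suc k ≤ ∣ A ∣ → Nonempty A
0<∣p∣⇒nonempty {n = n} A k<∣A∣ with nonempty? A
... | yes ne = ne
... | no ¬ne with subst (λ B → _ ≤ ∣ B ∣) (Empty-unique ¬ne) k<∣A∣
... | k<∣⊥∣ with subst (_ ≤_) (∣⊥∣≡0 n) k<∣⊥∣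
... | ()

fibre : Subset n → Subset n → Bool → Subset n
fibre A Y true  = A ∩ Y
fibre A Y false = A ∩ ∁ Y

∈-fibre⁻ : (A Y : Subset n) (b : Bool) → u ∈ fibre A Y b → u ∈ A × lookup Y u ≡ b
∈-fibre⁻ A Y true u∈ with x∈p∩q⁻ A Y u∈
... | u∈A , u∈Y = u∈A , []=⇒lookup u∈Y
∈-fibre⁻ {u = u} A Y false u∈ with x∈p∩q⁻ A (∁ Y) u∈
... | u∈A , u∈∁Y = u∈A , ¬-not (x∈∁p⇒x∉p u∈∁Y ∘ lookup⇒[]= u Y)

∣p∣≡∣fibres∣ : (A Y : Subset n) (b : Bool) →
               ∣ A ∣ ≡ ∣ fibre A Y b ∣ + ∣ fibre A Y (not b) ∣
∣p∣≡∣fibres∣ A Y true  = ∣p∣≡∣p∩q∣+∣p∩∁q∣ A Y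
∣p∣≡∣fibres∣ A Y false = trans (∣p∣≡∣p∩q∣+∣p∩∁q∣ A Y) (+-comm ∣ A ∩ Y ∣ _)

-- The surplus is claimed for the second alternative only: on that side one twin will be spent on a
-- swap.
+-pigeonhole : ∀ k {l m n} → k + l < m + n → k ≤ m ⊎ l < n
+-pigeonhole k {l} {m} {n} k+l<m+n with k ≤? m | l <? n
... | yes k≤m | _       = inj₁ k≤m
... | no  _   | yes l<n = inj₂ l<n
... | no  k≰m | no  l≮n =
  contradiction (+-mono-≤ (≰⇒> k≰m) (≮⇒≥ l≮n)) (<-asym k+l<m+n)

-- Transpositions.

-- A relation between a point and its image treats the two moved points and the fixed ones in a
-- single case analysis.
transpose-elim : (P : Fin n → Fin n → Set) (p q : Fin n) →
                 P p q → P q p → (∀ {u} → u ≢ p → u ≢ q → P u u) →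
                 ∀ u → P u (transpose p q ⟨$⟩ʳ u)
transpose-elim P p q pq qp fix u with u ≟ p
... | yes refl = pq
... | no u≢p with u ≟ q
...   | yes refl = qp
...   | no u≢q   = fix u≢p u≢q

transpose-movesˡ : (p q : Fin n) → transpose p q ⟨$⟩ʳ p ≡ q
transpose-movesˡ p q =
  transpose-elim (λ u v → u ≡ p → v ≡ q) p q
    (λ _ → refl) sym (λ u≢p _ u≡p → contradiction u≡p u≢p) p refl

transpose-movesʳ : (p q : Fin n) → transpose p q ⟨$⟩ʳ q ≡ p
transpose-movesʳ p q =
  transpose-elim (λ u v → u ≡ q → v ≡ p) p q
    sym (λ _ → refl) (λ _ u≢q u≡q → contradiction u≡q u≢q) q refl

transpose-fixes : u ≢ p → u ≢ q → transpose p q ⟨$⟩ʳ u ≡ u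
transpose-fixes {u = u} {p} {q} u≢p u≢q =
  transpose-elim (λ u v → u ≢ p → u ≢ q → v ≡ u) p q
    (λ p≢p _ → contradiction refl p≢p) (λ _ q≢q → contradiction refl q≢q)
    (λ _ _ _ _ → refl) u u≢p u≢q

-- Isomorphic valuations.

record Isomorphic (π : Permutation′ n) (ρ : Vec (Fin n) e) (σ : Vec (Subset n) s)
                  (ρ′ : Vec (Fin n) e) (σ′ : Vec (Subset n) s) : Set where
  constructor iso
  field
    elements : ∀ i → π ⟨$⟩ʳ lookup ρ i ≡ lookup ρ′ i
    sets     : ∀ i u → lookup (lookup σ i) u ≡ lookup (lookup σ′ i) (π ⟨$⟩ʳ u)

private
  variable
    ρ ρ′ : Vec (Fin n) e
    σ σ′ : Vec (Subset n) s
    X Y : Subset n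
    π : Permutation′ n

Isomorphic-sym : Isomorphic π ρ σ ρ′ σ′ → Isomorphic (flip π) ρ′ σ′ ρ σ
Isomorphic-sym {π = π} {σ′ = σ′} (iso elem set) = iso
  (λ i → trans (cong (π ⟨$⟩ˡ_) (sym (elem i))) (inverseˡ π))
  (λ i u → trans (cong (lookup (lookup σ′ i)) (sym (inverseʳ π)))
                 (sym (set i (π ⟨$⟩ˡ u))))

Isomorphic-∷ᵉ : π ⟨$⟩ʳ u ≡ v → Isomorphic π ρ σ ρ′ σ′ →
                Isomorphic π (u ∷ ρ) σ (v ∷ ρ′) σ′
Isomorphic-∷ᵉ eq (iso elem set) = iso (λ { zero → eq ; (suc i) → elem i }) set

Isomorphic-∷ˢ : (∀ u → lookup X u ≡ lookup Y (π ⟨$⟩ʳ u)) → Isomorphic π ρ σ ρ′ σ′ →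
                Isomorphic π ρ (X ∷ σ) ρ′ (Y ∷ σ′)
Isomorphic-∷ˢ eq (iso elem set) = iso elem (λ { zero → eq ; (suc i) → set i })

Isomorphic-refl : Isomorphic idₚ ρ σ ρ σ
Isomorphic-refl = iso (λ _ → refl) (λ _ _ → refl)

preimage : Permutation′ n → Subset n → Subset n
preimage π X = tabulate λ u → lookup X (π ⟨$⟩ʳ u)

lookup-preimage : (π : Permutation′ n) (X : Subset n) (u : Fin n) →
                  lookup (preimage π X) u ≡ lookup X (π ⟨$⟩ʳ u)
lookup-preimage π X = lookup∘tabulate _

lookup-image : (π : Permutation′ n) (X : Subset n) (u : Fin n) →
               lookup X u ≡ lookup (preimage (flip π) X) (π ⟨$⟩ʳ u)
lookup-image π X u =
  sym (trans (lookup-preimage (flip π) X _) (cong (lookup X) (inverseˡ π)))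

-- Twins and nearly equal valuations.

-- The transposition of p and a twin q fixes σ, and it fixes ρ if p does not occur in ρ.
record Twin (ρ : Vec (Fin n) e) (σ : Vec (Subset n) s) (p q : Fin n) : Set where
  constructor twin
  field
    distinct : q ≢ p
    unused   : ∀ i → lookup ρ i ≢ q
    alike    : ∀ i → lookup (lookup σ i) q ≡ lookup (lookup σ i) p

-- The carrier may be any set of twins, so a lower bound on their number needs no computation of all
-- of them.
record Abundant (k : ℕ) (ρ : Vec (Fin n) e) (σ : Vec (Subset n) s) (p : Fin n) : Set where
  constructor abundant
  field
    carrier : Subset n
    large   : k ≤ ∣ carrier ∣
    twins   : ∀ {q} → q ∈ carrier → Twin ρ σ p q

-- If some set contains `p` under one valuation only, no point is a twin of `p` under both; hence a
-- separate supply of twins for each.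
record Near (k : ℕ) (ρ : Vec (Fin n) e) (σ σ′ : Vec (Subset n) s) (p : Fin n) : Set where
  field
    fresh     : ∀ i → lookup ρ i ≢ p
    agree     : ∀ i {u} → u ≢ p → lookup (lookup σ i) u ≡ lookup (lookup σ′ i) u
    abundantˡ : Abundant k ρ σ p
    abundantʳ : Abundant k ρ σ′ p

open Near

Abundant-mono : k ≤ l → Abundant l ρ σ p → Abundant k ρ σ p
Abundant-mono k≤l (abundant A l≤∣A∣ twins) = abundant A (≤-trans k≤l l≤∣A∣) twins

Near-mono : k ≤ l → Near l ρ σ σ′ p → Near k ρ σ σ′ p
Near-mono k≤l near = record
  { fresh     = fresh near
  ; agree     = agree near
  ; abundantˡ = Abundant-mono k≤l (abundantˡ near)
  ; abundantʳ = Abundant-mono k≤l (abundantʳ near)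
  }

Near-sym : Near k ρ σ σ′ p → Near k ρ σ′ σ p
Near-sym near = record
  { fresh     = fresh near
  ; agree     = λ i u≢p → sym (agree near i u≢p)
  ; abundantˡ = abundantʳ near
  ; abundantʳ = abundantˡ near
  }

Abundant⇒Twin : Abundant (suc k) ρ σ p → ∃ (Twin ρ σ p)
Abundant⇒Twin (abundant A k<∣A∣ twins) with 0<∣p∣⇒nonempty A k<∣A∣
... | q , q∈A = q , twins q∈A

-- Only `u` itself can cease to be a twin.
Abundant-∷ᵉ : (u : Fin n) → Abundant (suc k) ρ σ p → Abundant k (u ∷ ρ) σ p
Abundant-∷ᵉ u (abundant A k<∣A∣ twins) =
  abundant (A ∩ ∁ ⁅ u ⁆) (remove-≤ A u k<∣A∣) λ q∈ →
    let q∈A , q≢u = ∈-remove⁻ A q∈ ; twin q≢p unused alike = twins q∈A in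
    twin q≢p (λ { zero u≡q → q≢u (sym u≡q) ; (suc i) → unused i }) alike

Near-∷ᵉ : u ≢ p → Near (suc k) ρ σ σ′ p → Near k (u ∷ ρ) σ σ′ p
Near-∷ᵉ {u = u} u≢p near = record
  { fresh     = λ { zero → u≢p ; (suc i) → fresh near i }
  ; agree     = agree near
  ; abundantˡ = Abundant-∷ᵉ u (abundantˡ near)
  ; abundantʳ = Abundant-∷ᵉ u (abundantʳ near)
  }

Twin-∷ˢ : lookup Y q ≡ lookup Y p → Twin ρ σ p q → Twin ρ (Y ∷ σ) p q
Twin-∷ˢ eq (twin q≢p unused alike) =
  twin q≢p unused λ { zero → eq ; (suc i) → alike i }

Twin⇒Isomorphic : (∀ i → lookup ρ i ≢ p) → Twin ρ σ p q →
                  Isomorphic (transpose p q) ρ σ ρ σ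
Twin⇒Isomorphic {p = p} {σ = σ} {q = q} unused-p (twin _ unused-q alike) = iso
  (λ i → transpose-fixes (unused-p i) (unused-q i))
  (λ i → transpose-elim (λ u v → lookup (lookup σ i) u ≡ lookup (lookup σ i) v) p q
           (sym (alike i)) (alike i) (λ _ _ → refl))

-- Answers to quantified elements and sets.

respondᵉ : Near (suc k) ρ σ σ′ p → (u : Fin n) →
           ∃[ π ] ∃[ v ] Isomorphic π (u ∷ ρ) σ (v ∷ ρ) σ × Near k (v ∷ ρ) σ σ′ p
respondᵉ {p = p} near u with u ≟ p
... | no u≢p   = idₚ , u , Isomorphic-refl , Near-∷ᵉ u≢p near
-- Swapping `p` with a twin fixes the valuation and moves the choice off `p`, to a point where both
-- valuations agree.
... | yes refl with Abundant⇒Twin (abundantˡ near)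
...   | q , q∼p =
  transpose p q , q ,
  Isomorphic-∷ᵉ (transpose-movesˡ p q) (Twin⇒Isomorphic (fresh near) q∼p) ,
  Near-∷ᵉ (Twin.distinct q∼p) near

-- The points in `opposite` are twins under `σ` but are separated from `p` by `Y`. There is one more
-- of them than in `same`, as `normalise` uses one up.
data Split (k : ℕ) (ρ : Vec (Fin n) e) (σ : Vec (Subset n) s) (p : Fin n)
           (Y : Subset n) : Set where
  same     : Abundant k ρ (Y ∷ σ) p → Split k ρ σ p Y
  opposite : (A : Subset n) → suc k ≤ ∣ A ∣ →
             (∀ {q} → q ∈ A → Twin ρ σ p q × lookup Y q ≡ not (lookup Y p)) →
             Split k ρ σ p Y

split : Abundant (suc (k + k)) ρ σ p → (Y : Subset n) → Split k ρ σ p Y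
split {k = k} {p = p} (abundant A 2k<∣A∣ twins) Y
  with +-pigeonhole k (subst (suc (k + k) ≤_) (∣p∣≡∣fibres∣ A Y (lookup Y p)) 2k<∣A∣)
... | inj₁ many = same (abundant (fibre A Y (lookup Y p)) many λ q∈ →
        let q∈A , eq = ∈-fibre⁻ A Y (lookup Y p) q∈ in Twin-∷ˢ eq (twins q∈A))
... | inj₂ many = opposite (fibre A Y (not (lookup Y p))) many λ q∈ →
        let q∈A , eq = ∈-fibre⁻ A Y (not (lookup Y p)) q∈ in twins q∈A , eq

-- If most twins lie on the other side of `Y`, swapping `p` with one of them, `q`, leaves `ρ` and
-- `σ` unchanged and puts `p` on the side of the rest.
normalise : (∀ i → lookup ρ i ≢ p) → Abundant (suc (k + k)) ρ σ p → (Y : Subset n) →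
            ∃[ π ] ∃[ Z ] Isomorphic π ρ (Y ∷ σ) ρ (Z ∷ σ) × Abundant k ρ (Z ∷ σ) p
normalise {ρ = ρ} {p = p} {σ = σ} unused ab Y with split ab Y
... | same ab′ = idₚ , Y , Isomorphic-refl , ab′
... | opposite A k<∣A∣ twins with 0<∣p∣⇒nonempty A k<∣A∣
...   | q , q∈A =
  transpose p q , Z ,
  Isomorphic-∷ˢ (lookup-image (transpose p q) Y)
    (Twin⇒Isomorphic unused (proj₁ (twins q∈A))) ,
  -- After the swap `q` has the former membership of `p`, so it is no longer a twin.
  abundant (A ∩ ∁ ⁅ q ⁆) (remove-≤ A q k<∣A∣) twins′
  where
  -- The inverse of `transpose p q` is `transpose q p`, so this is the image of `Y` under the swap.
  Z = preimage (transpose q p) Y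
  twins′ : ∀ {r} → r ∈ A ∩ ∁ ⁅ q ⁆ → Twin ρ (Z ∷ σ) p r
  twins′ {r} r∈ with ∈-remove⁻ A r∈
  ... | r∈A , r≢q with twins r∈A
  ...   | r∼p@(twin r≢p _ _) , Yr = Twin-∷ˢ (begin
    lookup Z r                             ≡⟨ lookup-preimage (transpose q p) Y r ⟩
    lookup Y (transpose q p ⟨$⟩ʳ r)        ≡⟨ cong (lookup Y) (transpose-fixes r≢q r≢p) ⟩
    lookup Y r                             ≡⟨ Yr ⟩
    not (lookup Y p)                       ≡⟨ proj₂ (twins q∈A) ⟨
    lookup Y q                             ≡⟨ cong (lookup Y) (transpose-movesʳ q p) ⟨
    lookup Y (transpose q p ⟨$⟩ʳ p)        ≡⟨ lookup-preimage (transpose q p) Y p ⟨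
    lookup Z p                             ∎) r∼p
    where open ≡-Reasoning

-- Under the second valuation the set is the answer to be chosen, and it has to match only off `p`;
-- toggling `p` itself reaches the larger side.
adjust : Abundant (suc (k + k)) ρ σ p → (Y : Subset n) →
         ∃[ Z ] (∀ {u} → u ≢ p → lookup Y u ≡ lookup Z u) × Abundant k ρ (Z ∷ σ) p
adjust {k = k} {ρ = ρ} {σ = σ} {p = p} ab Y with split ab Y
... | same ab′ = Y , (λ _ → refl) , ab′
... | opposite A k<∣A∣ twins =
  Z , unchanged , abundant A (≤-trans (n≤1+n _) k<∣A∣) λ q∈A →
    let q∼p , Yq = twins q∈A in
    Twin-∷ˢ (trans (sym (unchanged (Twin.distinct q∼p)))
                   (trans Yq (sym (lookup∘update p Y _)))) q∼p
  where
  Z = Y [ p ]≔ not (lookup Y p)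
  unchanged : ∀ {u} → u ≢ p → lookup Y u ≡ lookup Z u
  unchanged u≢p = sym (lookup∘update′ u≢p Y _)

respondˢ : Near (suc (k + k)) ρ σ σ′ p → (Y : Subset n) →
           ∃[ π ] ∃[ Z ] ∃[ Z′ ]
             Isomorphic π ρ (Y ∷ σ) ρ (Z ∷ σ) × Near k ρ (Z ∷ σ) (Z′ ∷ σ′) p
respondˢ near Y with normalise (fresh near) (abundantˡ near) Y
-- The already normalised `Z`, not `Y`, is adjusted, so that the two new sets agree off `p`.
... | π , Z , π-iso , ab with adjust (abundantʳ near) Z
...   | Z′ , Z≈Z′ , ab′ = π , Z , Z′ , π-iso , record
  { fresh     = fresh near
  ; agree     = λ { zero → Z≈Z′ ; (suc i) → agree near i }
  ; abundantˡ = ab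
  ; abundantʳ = ab′
  }

-- A supply of twins sufficient for `Sat-near`. The 2 is what `SET` atoms require, an element
-- quantifier costs one twin, and a set quantifier keeps at least k out of 2k + 1.
threshold : Formula e s → ℕ
threshold (x ≐ y) = 2
threshold (x ∈̇ X) = 2
threshold (SĖT X) = 2
threshold (¬̇ φ)   = threshold φ
threshold (φ ∧̇ ψ) = threshold φ ⊔ threshold ψ
threshold (φ ∨̇ ψ) = threshold φ ⊔ threshold ψ
threshold (φ ⇒̇ ψ) = threshold φ ⊔ threshold ψ
threshold (∃ᵉ φ)  = suc (threshold φ)
threshold (∀ᵉ φ)  = suc (threshold φ)
threshold (∃ˢ φ)  = suc (threshold φ + threshold φ)
threshold (∀ˢ φ)  = suc (threshold φ + threshold φ)

-- The family of a star, described through membership.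

TopOrSingleton : Subset n → Set
TopOrSingleton X = (∀ u → u ∈ X) ⊎ (∃ λ u → u ∈ X × (∀ {v} → v ∈ X → v ≡ u))

TopOrSingleton-iso : (π : Permutation′ n) →
                     (∀ u → lookup X u ≡ lookup Y (π ⟨$⟩ʳ u)) →
                     TopOrSingleton X → TopOrSingleton Y
TopOrSingleton-iso {X = X} {Y} π X≈Y = λ
  { (inj₁ full)               → inj₁ λ v → ∈-resp (pull v) (full (π ⟨$⟩ˡ v))
  ; (inj₂ (u , u∈X , unique)) → inj₂
      ( π ⟨$⟩ʳ u
      , ∈-resp (X≈Y u) u∈X
      , λ {v} v∈Y → trans (sym (inverseʳ π))
                          (cong (π ⟨$⟩ʳ_) (unique (∈-resp (sym (pull v)) v∈Y)))
      )
  }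
  where
  pull : ∀ v → lookup X (π ⟨$⟩ˡ v) ≡ lookup Y v
  pull v = trans (X≈Y _) (cong (lookup Y) (inverseʳ π))

-- Were the i-th sets to differ at p, both would contain the two twins of p in the one
-- containing p, and both would miss the twins in the other: neither would be ⊤ or a
-- singleton.
TopOrSingleton-near : Near 2 ρ σ σ′ p → ∀ i →
                      TopOrSingleton (lookup σ i) → TopOrSingleton (lookup σ′ i)
TopOrSingleton-near {σ = σ} {σ′} {p} near i = cases
  where
  F  = lookup σ i
  F′ = lookup σ′ i

  F⇒F′ : ∀ {u} → u ≢ p → u ∈ F → u ∈ F′
  F⇒F′ u≢p = ∈-resp (agree near i u≢p)

  F′⇒F : ∀ {u} → u ≢ p → u ∈ F′ → u ∈ F
  F′⇒F u≢p = ∈-resp (sym (agree near i u≢p))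

  cases : TopOrSingleton F → TopOrSingleton F′
  cases (inj₁ full) with Abundant⇒Twin (abundantʳ near)
  ... | q , twin q≢p _ q∼p = inj₁ full′
    where
    full′ : ∀ u → u ∈ F′
    full′ u with u ≟ p
    ... | yes refl = ∈-resp (q∼p i) (F⇒F′ q≢p (full q))
    ... | no u≢p   = F⇒F′ u≢p (full u)
  cases (inj₂ (u , u∈F , unique)) with u ≟ p
  ... | yes refl with Abundant⇒Twin (abundantˡ near)
  ...   | q , twin q≢p _ q∼p = contradiction (unique (∈-resp (sym (q∼p i)) u∈F)) q≢p
  cases (inj₂ (u , u∈F , unique)) | no u≢p with Abundant⇒Twin (abundantʳ near)
  ...   | q , twin q≢p _ q∼p with Abundant⇒Twin (Abundant-∷ᵉ q (abundantʳ near))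
  ...     | r , twin r≢p unused r∼p = inj₂ (u , F⇒F′ u≢p u∈F , unique′)
    where
    p∉F′ : p ∉ F′
    p∉F′ p∈F′ = unused zero (trans
      (unique (F′⇒F q≢p (∈-resp (sym (q∼p i)) p∈F′)))
      (sym (unique (F′⇒F r≢p (∈-resp (sym (r∼p i)) p∈F′)))))

    unique′ : ∀ {v} → v ∈ F′ → v ≡ u
    unique′ {v} v∈F′ with v ≟ p
    ... | yes refl = contradiction v∈F′ p∉F′
    ... | no v≢p   = unique (F′⇒F v≢p v∈F′)

-- Preservation of satisfaction.

module _ (S : SetSystem)
         (SET⇔ : ∀ X → SetSystem.SET S X ⇔ TopOrSingleton X) where
  open SetSystem S using (size)

  -- By `SET⇔` every permutation of the universe is an automorphism, so it is enough that the
  -- valuations correspond.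
  Sat-iso : (φ : Formula e s) {π : Permutation′ size}
            {ρ ρ′ : Vec (Fin size) e} {σ σ′ : Vec (Subset size) s} →
            Isomorphic π ρ σ ρ′ σ′ → Sat S φ ρ σ → Sat S φ ρ′ σ′
  Sat-iso (x ≐ y) {π} (iso elem _) eq = trans (sym (elem x)) (trans (cong (π ⟨$⟩ʳ_) eq) (elem y))
  Sat-iso (x ∈̇ X) {ρ = ρ} {σ′ = σ′} (iso elem set) =
    ∈-resp (trans (set X (lookup ρ x)) (cong (lookup (lookup σ′ X)) (elem x)))
  Sat-iso (SĖT X) {π} (iso _ set) = from (SET⇔ _) ∘ TopOrSingleton-iso π (set X) ∘ to (SET⇔ _)
  Sat-iso (¬̇ φ) π-iso ¬φ = ¬φ ∘ Sat-iso φ (Isomorphic-sym π-iso)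
  Sat-iso (φ ∧̇ ψ) π-iso (a , b) = Sat-iso φ π-iso a , Sat-iso ψ π-iso b
  Sat-iso (φ ∨̇ ψ) π-iso (inj₁ a) = inj₁ (Sat-iso φ π-iso a)
  Sat-iso (φ ∨̇ ψ) π-iso (inj₂ b) = inj₂ (Sat-iso ψ π-iso b)
  Sat-iso (φ ⇒̇ ψ) π-iso f = Sat-iso ψ π-iso ∘ f ∘ Sat-iso φ (Isomorphic-sym π-iso)
  Sat-iso (∃ᵉ φ) {π} π-iso (u , h) = π ⟨$⟩ʳ u , Sat-iso φ (Isomorphic-∷ᵉ refl π-iso) h
  Sat-iso (∀ᵉ φ) {π} π-iso h u = Sat-iso φ (Isomorphic-∷ᵉ (inverseʳ π) π-iso) (h (π ⟨$⟩ˡ u))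
  Sat-iso (∃ˢ φ) {π} π-iso (X , h) =
    preimage (flip π) X , Sat-iso φ (Isomorphic-∷ˢ (lookup-image π X) π-iso) h
  Sat-iso (∀ˢ φ) {π} π-iso h X =
    Sat-iso φ (Isomorphic-∷ˢ (lookup-preimage π X) π-iso) (h (preimage π X))

  -- At a quantifier, a permutation first replaces the choice by an equivalent one under the same
  -- valuation; the answer under the other valuation then keeps the two near, with the threshold of
  -- the body.
  Sat-near : (φ : Formula e s) {p : Fin size}
             {ρ : Vec (Fin size) e} {σ σ′ : Vec (Subset size) s} →
             Near (threshold φ) ρ σ σ′ p → Sat S φ ρ σ → Sat S φ ρ σ′
  Sat-near (x ≐ y) near eq = eq
  Sat-near (x ∈̇ X) near = ∈-resp (agree near X (fresh near x))
  Sat-near (SĖT X) near = from (SET⇔ _) ∘ TopOrSingleton-near near X ∘ to (SET⇔ _)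
  Sat-near (¬̇ φ) near ¬φ = ¬φ ∘ Sat-near φ (Near-sym near)
  Sat-near (φ ∧̇ ψ) near (a , b) =
    Sat-near φ (Near-mono (m≤m⊔n _ _) near) a , Sat-near ψ (Near-mono (m≤n⊔m _ _) near) b
  Sat-near (φ ∨̇ ψ) near (inj₁ a) = inj₁ (Sat-near φ (Near-mono (m≤m⊔n _ _) near) a)
  Sat-near (φ ∨̇ ψ) near (inj₂ b) = inj₂ (Sat-near ψ (Near-mono (m≤n⊔m _ _) near) b)
  Sat-near (φ ⇒̇ ψ) near f =
    Sat-near ψ (Near-mono (m≤n⊔m _ _) near) ∘ f ∘
    Sat-near φ (Near-sym (Near-mono (m≤m⊔n _ _) near))
  Sat-near (∃ᵉ φ) near (u , h) with respondᵉ near u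
  ... | _ , v , π-iso , near′ = v , Sat-near φ near′ (Sat-iso φ π-iso h)
  -- The challenge is posed under `σ′`, so it is answered from that side, and the inverse
  -- isomorphism returns to the original challenge.
  Sat-near (∀ᵉ φ) near h u with respondᵉ (Near-sym near) u
  ... | _ , v , π-iso , near′ =
    Sat-iso φ (Isomorphic-sym π-iso) (Sat-near φ (Near-sym near′) (h v))
  Sat-near (∃ˢ φ) near (Y , h) with respondˢ near Y
  ... | _ , _ , Z′ , π-iso , near′ = Z′ , Sat-near φ near′ (Sat-iso φ π-iso h)
  Sat-near (∀ˢ φ) near h Y with respondˢ (Near-sym near) Y
  ... | _ , _ , Z′ , π-iso , near′ =
    Sat-iso φ (Isomorphic-sym π-iso) (Sat-near φ (Near-sym near′) (h Z′))

-- A near pair of subsets, and parity.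

initial : k ≤ n → ∃ λ (Z : Subset n) → ∣ Z ∣ ≡ k
initial {n = n} z≤n = ⊥ , ∣⊥∣≡0 n
initial (s≤s k≤n) with initial k≤n
... | Z , eq = inside ∷ Z , cong suc eq

-- The distinguished point is `zero`. When it is outside, its twins are the points outside `Z`; when
-- inside, the points of `Z`. With k points in `Z`, both supplies reach k.
near-subsets : ∀ k → k + k ≤ n →
               ∃ λ (Z : Subset n) → Near k [] ((outside ∷ Z) ∷ []) ((inside ∷ Z) ∷ []) zero
near-subsets {n} k 2k≤n with initial (≤-trans (m≤m+n k k) 2k≤n)
... | Z , ∣Z∣≡k = Z , record
  { fresh     = λ ()
  ; agree     = λ { zero {zero} 0≢0 → contradiction refl 0≢0 ; zero {suc _} _ → refl }
  ; abundantˡ = abundant (outside ∷ ∁ Z) k≤∣∁Z∣ λ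
      { (there v∈) → twin (λ ()) (λ ()) λ { zero → ¬-not (x∈∁p⇒x∉p v∈ ∘ lookup⇒[]= _ Z) } }
  ; abundantʳ = abundant (outside ∷ Z) (≤-reflexive (sym ∣Z∣≡k)) λ
      { (there v∈) → twin (λ ()) (λ ()) λ { zero → []=⇒lookup v∈ } }
  }
  where
  open ≤-Reasoning
  k≤∣∁Z∣ : k ≤ ∣ ∁ Z ∣
  k≤∣∁Z∣ = begin
    k             ≡⟨ m+n∸n≡m k k ⟨
    k + k ∸ k     ≤⟨ ∸-monoˡ-≤ k 2k≤n ⟩
    n ∸ k         ≡⟨ cong (n ∸_) ∣Z∣≡k ⟨
    n ∸ ∣ Z ∣     ≡⟨ ∣∁p∣≡n∸∣p∣ Z ⟨
    ∣ ∁ Z ∣       ∎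

2∣n∨2∣1+n : ∀ n → (2 ∣ n) ⊎ (2 ∣ suc n)
2∣n∨2∣1+n zero = inj₁ (divides 0 refl)
2∣n∨2∣1+n (suc n) with 2∣n∨2∣1+n n
... | inj₁ 2∣n   = inj₂ (∣m∣n⇒∣m+n {m = 2} ∣-refl 2∣n)
... | inj₂ 2∣1+n = inj₁ 2∣1+n

2∣n⇒2∤1+n : 2 ∣ n → ¬ 2 ∣ suc n
2∣n⇒2∤1+n {n} 2∣n 2∣1+n
  with ∣1⇒≡1 (∣m+n∣m⇒∣n {2} {n} {1} (subst (2 ∣_) (+-comm 1 n) 2∣1+n) 2∣n)
... | ()

-- Laminar set systems whose tree is a star.

module StarTree (S : SetSystem) (laminar : Laminar S)
                (𝒯 : RootedTree) (tree : 𝒯 IsLaminarTreeOf S)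
                (star : RootedTree.IsStar 𝒯) where
  open SetSystem S
  open Laminar laminar
  open RootedTree 𝒯
  open _IsLaminarTreeOf_ tree

  ∈-children : ∀ {u v} → parent u ≡ just v → u ∈ children v
  ∈-children {u} {v} eq =
    lookup⇒[]= u _ (trans (lookup∘tabulate _ u) (dec-true (≡-dec _≟_ _ _) eq))

  root-or-child : ∀ {v} → Descendant v root → v ≡ root ⊎ v ∈ children root
  root-or-child ε = inj₁ refl
  root-or-child (v→w ◅ w→*root) with root-or-child w→*root
  ... | inj₁ refl  = inj₂ (∈-children v→w)
  ... | inj₂ child = contradiction (_ , ∈-children v→w) (star child)

  leaf-minimal : ∀ {u v} → IsLeaf v → Descendant u v → u ≡ v
  leaf-minimal leaf ε = refl
  leaf-minimal leaf (u→w ◅ w→*v) with leaf-minimal leaf w→*v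
  ... | refl = contradiction (_ , ∈-children u→w) leaf

  nodeOf : ∀ {F} → SET F → ∃ λ v → setOf v ≡ F
  nodeOf F∈ with Bijection.strictlySurjective nodes⤖members (_ , F∈)
  ... | v , eq = v , cong proj₁ eq

  setOf-injective : ∀ {u v} → setOf u ≡ setOf v → u ≡ v
  setOf-injective eq = Bijection.injective nodes⤖members (Σ-≡,≡→≡ (eq , T-irrelevant _ _))

  -- The universe is the set of some node, and that node is a descendant of the root.
  setOf-root : setOf root ≡ ⊤
  setOf-root with nodeOf universe∈
  ... | v , eq = ⊆-antisym ⊆⊤
    (subst (_⊆ setOf root) eq (to (descendant⇔⊆ v root) (root-top v)))

  -- For a point `u` of the leaf's set, the node of `⁅ u ⁆` is a descendant of the leaf, hence the
  -- leaf itself.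
  setOf-leaf : ∀ {v} → IsLeaf v → ∃ λ u → setOf v ≡ ⁅ u ⁆
  setOf-leaf {v} leaf with members-nonempty (proj₂ (Bijection.to nodes⤖members v))
  ... | u , u∈v with nodeOf (singleton∈ u)
  ...   | w , w≡⁅u⁆ = u , trans (cong setOf (sym w≡v)) w≡⁅u⁆
    where
    w⊆v : setOf w ⊆ setOf v
    w⊆v x∈w with x∈⁅y⁆⇒x≡y u (subst (_ ∈_) w≡⁅u⁆ x∈w)
    ... | refl = u∈v
    w≡v : w ≡ v
    w≡v = leaf-minimal leaf (from (descendant⇔⊆ w v) w⊆v)

  classify : ∀ v → setOf v ≡ ⊤ ⊎ ∃ λ u → setOf v ≡ ⁅ u ⁆
  classify v with root-or-child (root-top v)
  ... | inj₁ refl  = inj₁ setOf-root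
  ... | inj₂ child = inj₂ (setOf-leaf (star child))

  SET⇔TopOrSingleton : ∀ F → SET F ⇔ TopOrSingleton F
  SET⇔TopOrSingleton F = mk⇔ forth back
    where
    forth : SET F → TopOrSingleton F
    forth F∈ with nodeOf F∈
    ... | v , refl with classify v
    ...   | inj₁ eq       = inj₁ λ u → subst (u ∈_) (sym eq) ∈⊤
    ...   | inj₂ (u , eq) = inj₂ (u , subst (u ∈_) (sym eq) (x∈⁅x⁆ u) ,
                                  λ {v} v∈ → x∈⁅y⁆⇒x≡y u (subst (v ∈_) eq v∈))

    back : TopOrSingleton F → SET F
    back (inj₁ full) = subst SET (⊆-antisym (λ _ → full _) ⊆⊤) universe∈
    back (inj₂ (u , u∈F , unique)) = subst SET (⊆-antisym ⁅u⁆⊆F F⊆⁅u⁆) (singleton∈ u)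
      where
      ⁅u⁆⊆F : ⁅ u ⁆ ⊆ F
      ⁅u⁆⊆F x∈ = subst (_∈ F) (sym (x∈⁅y⁆⇒x≡y u x∈)) u∈F
      F⊆⁅u⁆ : F ⊆ ⁅ u ⁆
      F⊆⁅u⁆ x∈F = subst (_∈ ⁅ u ⁆) (sym (unique x∈F)) (x∈⁅x⁆ u)

  -- Coding nodes by the universe or a point bounds their number, so many children force a large
  -- universe.
  code : Node → Fin (suc size)
  code v with classify v
  ... | inj₁ _       = zero
  ... | inj₂ (u , _) = suc u

  code-injective : ∀ {u v} → code u ≡ code v → u ≡ v
  code-injective {u} {v} eq with classify u | classify v
  code-injective eq   | inj₁ p       | inj₁ q       = setOf-injective (trans p (sym q))
  code-injective refl | inj₂ (x , p) | inj₂ (y , q) = setOf-injective (trans p (sym q))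

  children≤1+size : ∣ children root ∣ ≤ suc size
  children≤1+size = ≤-trans (∣p∣≤n (children root)) (injective⇒≤ code-injective)

-- Undefinability of parity.

EVEN-not-defined : (S : SetSystem) → (∀ X → SetSystem.SET S X ⇔ TopOrSingleton X) →
                   (φ : Formula 0 1) →
                   suc (threshold φ + threshold φ) ≤ SetSystem.size S →
                   ¬ (∀ X → Sat S φ [] (X ∷ []) ⇔ EVEN X)
EVEN-not-defined S@(record { size = suc n }) SET⇔ φ (s≤s 2t≤n) defines
  with near-subsets (threshold φ) 2t≤n
-- The two near sets have consecutive cardinalities, so exactly one is even, yet `φ` holds of both
-- or of neither.
... | Z , near with 2∣n∨2∣1+n ∣ Z ∣
...   | inj₁ even = 2∣n⇒2∤1+n even
  (to (defines (inside ∷ Z)) (Sat-near S SET⇔ φ near (from (defines (outside ∷ Z)) even)))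
...   | inj₂ even = 2∣n⇒2∤1+n
  (to (defines (outside ∷ Z))
    (Sat-near S SET⇔ φ (Near-sym near) (from (defines (inside ∷ Z)) even)))
  even

theorem4 : ∀ {ℓ} (𝓛 : Pred SetSystem ℓ) →
    (∀ S → 𝓛 S → Laminar S) →
    (∀ (n : ℕ) →
    Σ SetSystem λ S → 𝓛 S ×
    Σ RootedTree λ 𝒯 → 𝒯 IsLaminarTreeOf S × RootedTree.IsStar 𝒯 ×
    n ≤ ∣ RootedTree.children 𝒯 (RootedTree.root 𝒯) ∣) →
    ¬ Definable EVEN 𝓛
theorem4 𝓛 laminar stars (φ , defines) =
  -- One `suc` offsets the root counted in `children≤1+size`; the other provides the distinguished
  -- point besides the points that supply twins.
  let S , S∈𝓛 , 𝒯 , tree , star , many = stars (suc (suc (threshold φ + threshold φ)))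
      module Tree = StarTree S (laminar S S∈𝓛) 𝒯 tree star
  in EVEN-not-defined S Tree.SET⇔TopOrSingleton φ
       (s≤s⁻¹ (≤-trans many Tree.children≤1+size)) (defines S S∈𝓛)
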